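{- For every integer $n\geq 1$, the largest number $r(n)$ of red internal nodes in a red-black tree on $n$ keys satisfies $$r(n)=\begin{cases} n-\lfloor\log n\rfloor & \text{if } n<8,\\ r(p)+q & \text{if } n\geq 8,\end{cases}$$ where $$p=2^{\lfloor\log n\rfloor-2}+\left\lceil\frac{n-2^{\lfloor\log n\rfloor}+1}{4}\right\rceil-1,\qquad q=n-2^{\lfloor\log n\rfloor-1}-2\left\lceil\frac{n-2^{\lfloor\log n\rfloor}+1}{4}\right\rceil+1.$$
   Context: Here $\log$ denotes the base-2 logarithm. A (relaxed) red-black tree on $n$ keys is a binary search tree with $n$ internal nodes (the nodes holding keys), in which every missing child is regarded as a leaf (NIL), together with a coloring of its nodes such that: each node is either red or black; all leaves (NIL) are black; every red node has two black children (NIL leaves count as black); and, for every node, every path from that node to a descendant leaf contains the same number of black nodes. The root may be red or black. $r(n)$ denotes the maximum, over all red-black trees on $n$ keys, of the number of red internal nodes. -}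

module Defs where

open import Data.Nat using (ℕ; _+_; _*_; _∸_; _^_; _≤_; _<_; NonZero)
open import Data.Nat.DivMod using (_/_)
open import Data.Nat.Logarithm using (⌊log₂_⌋)
open import Data.Product using (_×_; _,_; proj₂; ∃-syntax)
open import Data.Tree.Binary using (Tree; leaf; node; #nodes)
open import Data.Tree.Binary.Relation.Unary.All using (All)
open import Data.Unit using (⊤)
open import Function using (_∘_)
open import Relation.Binary.PropositionalEquality using (_≡_)
open import Relation.Unary using (U)

data Color : Set where
  red black : Color

-- Internal nodes carry a colour and a key; the `leaf`s are the NILs.
ColoredTree : Set
ColoredTree = Tree (Color × ℕ) ⊤

color : ColoredTree → Color
color (leaf _)           = black
color (node _ (c , _) _) = c

redOne blackOne : Color → ℕ
redOne   red   = 1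
redOne   black = 0
blackOne red   = 0
blackOne black = 1

#red : ColoredTree → ℕ
#red (leaf _)           = 0
#red (node l (c , _) r) = #red l + redOne c + #red r

-- s ⊑ t : s is the subtree of t rooted at some node of t, NIL leaves included.
infix 4 _⊑_

data _⊑_ (s : ColoredTree) : ColoredTree → Set where
  here  : s ⊑ s
  left  : ∀ {l m r} → s ⊑ l → s ⊑ node l m r
  right : ∀ {l m r} → s ⊑ r → s ⊑ node l m r

-- Downward paths from the root of a tree to one of its NIL leaves.
data Path : ColoredTree → Set where
  stop  : ∀ {x} → Path (leaf x)
  left  : ∀ {l m r} → Path l → Path (node l m r)
  right : ∀ {l m r} → Path r → Path (node l m r)

-- Both endpoints of the path are counted.
#black : ∀ {t} → Path t → ℕ
#black {t} stop      = blackOne (color t)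
#black {t} (left π)  = blackOne (color t) + #black π
#black {t} (right π) = blackOne (color t) + #black π

AllKeys : (ℕ → Set) → ColoredTree → Set
AllKeys P = All (P ∘ proj₂) U

IsSearchTree : ColoredTree → Set
IsSearchTree t = ∀ {l c k r} → node l (c , k) r ⊑ t →
                 AllKeys (_< k) l × AllKeys (k <_) r

RedHasBlackChildren : ColoredTree → Set
RedHasBlackChildren t = ∀ {l k r} → node l (red , k) r ⊑ t →
                        color l ≡ black × color r ≡ black

BlackBalanced : ColoredTree → Set
BlackBalanced t = ∀ {s} → s ⊑ t → (π ρ : Path s) → #black π ≡ #black ρ

-- The root is not required to be black.
record IsRedBlack (t : ColoredTree) : Set where
  field
    searchTree          : IsSearchTree t
    redHasBlackChildren : RedHasBlackChildren t
    blackBalanced       : BlackBalanced t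

record IsMaxRed (n m : ℕ) : Set where
  field
    attained   : ∃[ t ] (IsRedBlack t × #nodes t ≡ n × #red t ≡ m)
    upperBound : ∀ t → IsRedBlack t → #nodes t ≡ n → #red t ≤ m

⌈_/_⌉ : (m d : ℕ) .{{_ : NonZero d}} → ℕ
⌈ m / d ⌉ = (m + (d ∸ 1)) / d

-- For n ≥ 8 no subtraction below is truncated: ⌊log₂ n ⌋ ≥ 3, 2 ^ ⌊log₂ n ⌋ ≤ n,
-- and the ceiling c satisfies 1 ≤ c and 2 ^ (⌊log₂ n ⌋ ∸ 1) + 2 * c ≤ n.
p q : ℕ → ℕ
p n = 2 ^ (⌊log₂ n ⌋ ∸ 2) + ⌈ (n ∸ 2 ^ ⌊log₂ n ⌋ + 1) / 4 ⌉ ∸ 1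
q n = n ∸ 2 ^ (⌊log₂ n ⌋ ∸ 1) ∸ 2 * ⌈ (n ∸ 2 ^ ⌊log₂ n ⌋ + 1) / 4 ⌉ + 1

{-# OPTIONS --safe #-}

-- With red nodes contracted into their parents, every black node has between 2 and
-- 4 black children, all on the next lower black level. Hence in a tree on n ≥ 2 keys,
-- i.e. with n + 1 NILs, the lowest level of black internal nodes has at least
-- ⌈(n + 1)/4⌉ = 1 + ⌊n/4⌋ elements, and turning these into NILs leaves a red-black
-- tree on at least ⌊n/4⌋ keys. Conversely, any tree on ⌊n/4⌋ keys can be extended by
-- one level to n keys. So the least number b(n) of black nodes satisfies
-- b(n) = 1 + ⌊n/4⌋ + b(⌊n/4⌋) for n ≥ 2, and r(n) = n − b(n). In these terms
-- p = ⌊n/4⌋ and q = n − 2(1 + ⌊n/4⌋) + 1.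

module Submission where

open import Defs
open import Data.Nat using (ℕ; zero; suc; _+_; _*_; _∸_; _^_; _⊓_; _≤_; _<_; _≥_; z≤n; s≤s; s≤s⁻¹; NonZero; >-nonZero; ⌊_/2⌋; ⌈_/2⌉)
open import Data.Nat.DivMod
  using (_/_; _%_; m≡m%n+[m/n]*n; m%n<n; m/n*n≤m; m*n/n≡m; m/n<m; m<n*o⇒m/o<n; +-distrib-/-∣ˡ)
open import Data.Nat.Divisibility using (n∣m*n)
open import Data.Nat.Induction using (<-rec; <-wellFounded)
open import Data.Nat.Logarithm using (⌊log₂_⌋; ⌊log₂⌋-mono-≤)
open import Data.Nat.Logarithm.Core using (⌊log2⌋)
open import Data.Nat.Properties
open import Data.Nat.Tactic.RingSolver using (solve-∀)
open import Data.Product using (_×_; _,_; proj₁; proj₂; ∃-syntax; Σ-syntax)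
open import Data.Tree.Binary using (leaf; node; #nodes)
open import Data.Tree.Binary.Relation.Unary.All as All using (leaf; node)
open import Data.Unit using (tt)
open import Function using (_∘_)
open import Induction.WellFounded using (Acc; acc)
open import Relation.Binary.PropositionalEquality
  using (_≡_; refl; sym; trans; cong; cong₂; subst; module ≡-Reasoning)
open import Relation.Nullary using (contradiction)

-- Red-black trees with the keys forgotten.

private
  variable
    h : ℕ
    c d : Color

-- The index h is the black height, not counting the NIL.
data Shape : ℕ → Color → Set where
  nil       : Shape 0 black
  redNode   : Shape h black → Shape h black → Shape h red
  blackNode : Shape h c → Shape h d → Shape (suc h) black

leaves reds blacks : Shape h c → ℕ

leaves nil             = 1
leaves (redNode l r)   = leaves l + leaves r
leaves (blackNode l r) = leaves l + leaves r

reds nil             = 0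
reds (redNode l r)   = reds l + 1 + reds r
reds (blackNode l r) = reds l + 0 + reds r

blacks nil             = 0
blacks (redNode l r)   = blacks l + blacks r
blacks (blackNode l r) = suc (blacks l + blacks r)

-- A binary tree has one NIL more than internal nodes.
leaves≡1+reds+blacks : (s : Shape h c) → leaves s ≡ suc (reds s + blacks s)
leaves≡1+reds+blacks nil = refl
leaves≡1+reds+blacks (redNode l r) =
  trans (cong₂ _+_ (leaves≡1+reds+blacks l) (leaves≡1+reds+blacks r))
        (eq (reds l) (blacks l) (reds r) (blacks r))
  where
  eq : ∀ a b x y → suc (a + b) + suc (x + y) ≡ suc (a + 1 + x + (b + y))
  eq = solve-∀
leaves≡1+reds+blacks (blackNode l r) =
  trans (cong₂ _+_ (leaves≡1+reds+blacks l) (leaves≡1+reds+blacks r))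
        (eq (reds l) (blacks l) (reds r) (blacks r))
  where
  eq : ∀ a b x y → suc (a + b) + suc (x + y) ≡ suc (a + 0 + x + suc (b + y))
  eq = solve-∀

leaves>0 : (s : Shape h c) → 0 < leaves s
leaves>0 s rewrite leaves≡1+reds+blacks s = s≤s z≤n

reds≡ : ∀ {n} (s : Shape h c) → leaves s ≡ suc n → reds s ≡ n ∸ blacks s
reds≡ s eq with refl ← trans (sym (leaves≡1+reds+blacks s)) eq =
  sym (m+n∸n≡m (reds s) (blacks s))

-- Removing the lowest black level.

height0⇒leaves≤2 : (s : Shape 0 c) → leaves s ≤ 2
height0⇒leaves≤2 nil               = s≤s z≤n
height0⇒leaves≤2 (redNode nil nil) = ≤-refl

-- The colour index survives because a NIL is black like the node it replaces, so red parents stay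
-- legal.
trim : Shape (suc h) c → Shape h c
trim (redNode l r)           = redNode (trim l) (trim r)
trim {zero}  (blackNode l r) = nil
trim {suc h} (blackNode l r) = blackNode (trim l) (trim r)

-- Each NIL of `trim s` replaces a black node whose two subtrees have black height 0, hence at most
-- two NILs each.
leaves≤trim*4 : (s : Shape (suc h) c) → leaves s ≤ leaves (trim s) * 4
leaves≤trim*4 (redNode l r)
  rewrite *-distribʳ-+ 4 (leaves (trim l)) (leaves (trim r)) =
  +-mono-≤ (leaves≤trim*4 l) (leaves≤trim*4 r)
leaves≤trim*4 {zero} (blackNode l r) =
  +-mono-≤ (height0⇒leaves≤2 l) (height0⇒leaves≤2 r)
leaves≤trim*4 {suc h} (blackNode l r)
  rewrite *-distribʳ-+ 4 (leaves (trim l)) (leaves (trim r)) =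
  +-mono-≤ (leaves≤trim*4 l) (leaves≤trim*4 r)

height0⇒blacks≡0 : (s : Shape 0 c) → blacks s ≡ 0
height0⇒blacks≡0 nil               = refl
height0⇒blacks≡0 (redNode nil nil) = refl

+-interchange : ∀ a b x y → (a + b) + (x + y) ≡ (a + x) + (b + y)
+-interchange = solve-∀

-- The black nodes removed correspond one to one to the NILs of `trim s`.
blacks≡trim : (s : Shape (suc h) c) → blacks s ≡ leaves (trim s) + blacks (trim s)
blacks≡trim (redNode l r) =
  trans (cong₂ _+_ (blacks≡trim l) (blacks≡trim r))
        (+-interchange (leaves (trim l)) _ _ _)
blacks≡trim {zero} (blackNode l r) =
  cong suc (cong₂ _+_ (height0⇒blacks≡0 l) (height0⇒blacks≡0 r))
blacks≡trim {suc h} (blackNode l r) =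
  trans (cong suc (cong₂ _+_ (blacks≡trim l) (blacks≡trim r)))
        (eq (leaves (trim l)) _ _ _)
  where
  eq : ∀ a b x y → suc ((a + b) + (x + y)) ≡ (a + x) + suc (b + y)
  eq = solve-∀

-- Adding a black level at the bottom.

-- Every NIL becomes a black node with two to four NILs below it; the excess counts
-- the NILs beyond two, summed over these black nodes.
Grown : Shape h c → ℕ → Set
Grown {h} {c} s excess =
  Σ[ s′ ∈ Shape (suc h) c ] leaves s′ ≡ 2 * leaves s + excess × blacks s′ ≡ leaves s + blacks s

-- Here `a` and `b` count the NILs of two siblings. The excess is shared greedily: the left sibling
-- takes up to its capacity `2 * a`, the right one the rest.
module Split (a b : ℕ) {e : ℕ} (e≤ : e ≤ 2 * (a + b)) where
  eˡ eʳ : ℕ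
  eˡ = 2 * a ⊓ e
  eʳ = e ∸ 2 * a

  eˡ≤ : eˡ ≤ 2 * a
  eˡ≤ = m⊓n≤m (2 * a) e

  eʳ≤ : eʳ ≤ 2 * b
  eʳ≤ = m≤n+o⇒m∸n≤o e (2 * a) (subst (e ≤_) (*-distribˡ-+ 2 a b) e≤)

  leaves-eq : (2 * a + eˡ) + (2 * b + eʳ) ≡ 2 * (a + b) + e
  leaves-eq = begin
    (2 * a + eˡ) + (2 * b + eʳ) ≡⟨ +-interchange (2 * a) eˡ (2 * b) eʳ ⟩
    (2 * a + 2 * b) + (eˡ + eʳ) ≡⟨ cong₂ _+_ (sym (*-distribˡ-+ 2 a b)) (m⊓n+n∸m≡n (2 * a) e) ⟩
    2 * (a + b) + e             ∎
    where open ≡-Reasoning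

-- A black node put in place of a NIL may have zero, one or two red children, each worth one extra
-- NIL, so every excess up to twice the number of NILs occurs.
grow : ∀ {e} (s : Shape h c) → e ≤ 2 * leaves s → Grown s e
grow {e = 0} nil _ = blackNode nil nil , refl , refl
grow {e = 1} nil _ = blackNode (redNode nil nil) nil , refl , refl
grow {e = 2} nil _ = blackNode (redNode nil nil) (redNode nil nil) , refl , refl
grow {e = suc (suc (suc _))} nil (s≤s (s≤s ()))
grow (redNode l r) e≤ =
  let open Split (leaves l) (leaves r) e≤
      l′ , leavesˡ , blacksˡ = grow l eˡ≤
      r′ , leavesʳ , blacksʳ = grow r eʳ≤
  in redNode l′ r′
   , trans (cong₂ _+_ leavesˡ leavesʳ) leaves-eq
   , trans (cong₂ _+_ blacksˡ blacksʳ) (+-interchange (leaves l) (blacks l) _ _)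
grow (blackNode l r) e≤ =
  let open Split (leaves l) (leaves r) e≤
      l′ , leavesˡ , blacksˡ = grow l eˡ≤
      r′ , leavesʳ , blacksʳ = grow r eʳ≤
  in blackNode l′ r′
   , trans (cong₂ _+_ leavesˡ leavesʳ) leaves-eq
   , trans (cong suc (trans (cong₂ _+_ blacksˡ blacksʳ) (+-interchange (leaves l) (blacks l) _ _)))
           (sym (+-suc (leaves l + leaves r) (blacks l + blacks r)))

-- The least number of black nodes.

-- The lower bound covers all shapes with at least n keys, so that it can be applied
-- to a trimmed shape, whose number of keys is known only up to an inequality.
record IsMinBlack (n b : ℕ) : Set where
  field
    {height}   : ℕ
    {top}      : Color
    shape      : Shape height top
    #leaves≡   : leaves shape ≡ suc n
    #blacks≡   : blacks shape ≡ b
    lowerBound : ∀ {h c} (s : Shape h c) → n < leaves s → b ≤ blacks s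

open IsMinBlack

isMinBlack-unique : ∀ {n b b′} → IsMinBlack n b → IsMinBlack n b′ → b ≡ b′
isMinBlack-unique m m′ = ≤-antisym (le m m′) (le m′ m)
  where
  le : ∀ {n b b′} → IsMinBlack n b → IsMinBlack n b′ → b ≤ b′
  le m m′ = subst (_ ≤_) (#blacks≡ m′) (lowerBound m (shape m′) (≤-reflexive (sym (#leaves≡ m′))))

isMinBlack-≤ : ∀ {n b} → IsMinBlack n b → b ≤ n
isMinBlack-≤ {n} {b} m = subst (_≤ n) (#blacks≡ m)
  (s≤s⁻¹ (≤-trans (s≤s (m≤n+m (blacks (shape m)) (reds (shape m))))
                  (≤-reflexive (trans (sym (leaves≡1+reds+blacks (shape m))) (#leaves≡ m)))))

n<[1+n/4]*4 : ∀ n → n < suc (n / 4) * 4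
n<[1+n/4]*4 n = begin-strict
  n                   ≡⟨ m≡m%n+[m/n]*n n 4 ⟩
  n % 4 + n / 4 * 4   <⟨ +-monoˡ-< (n / 4 * 4) (m%n<n n 4) ⟩
  suc (n / 4) * 4     ∎
  where open ≤-Reasoning

-- Makes the excess in `isMinBlack-step` and the subtraction in `maxRed-rec` exact. If the quotient
-- is 0 this is the hypothesis; otherwise four times the quotient suffices.
2*[1+n/4]≤n : ∀ {n} → 2 ≤ n → 2 * suc (n / 4) ≤ n
2*[1+n/4]≤n {n} 2≤n with n / 4 | m/n*n≤m n 4
... | zero  | _   = 2≤n
... | suc k | k*4≤n = ≤-trans (subst (2 * suc (suc k) ≤_) (eq k) (m≤m+n _ (2 * k))) k*4≤n
  where
  eq : ∀ k → 2 * suc (suc k) + 2 * k ≡ suc k * 4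
  eq = solve-∀

isMinBlack-step : ∀ {n b} → 2 ≤ n → IsMinBlack (n / 4) b → IsMinBlack n (suc (n / 4) + b)
isMinBlack-step {n} {b} 2≤n m =
  let s , leavesₛ , blacksₛ = grow (shape m) excess≤ in record
  { shape      = s
  ; #leaves≡   = trans leavesₛ (trans (cong (λ k → 2 * k + excess) (#leaves≡ m))
                                      (m+[n∸m]≡n (≤-trans (2*[1+n/4]≤n 2≤n) (n≤1+n n))))
  ; #blacks≡   = trans blacksₛ (cong₂ _+_ (#leaves≡ m) (#blacks≡ m))
  ; lowerBound = lower
  }
  where
  excess : ℕ
  -- The grown shape needs `suc n` NILs, and each of the `suc (n / 4)` new black nodes supplies two
  -- in any case.
  excess = suc n ∸ 2 * suc (n / 4)

  excess≤ : excess ≤ 2 * leaves (shape m)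
  excess≤ rewrite #leaves≡ m =
    m≤n+o⇒m∸n≤o (suc n) (2 * suc (n / 4))
      (subst (n <_) (eq (suc (n / 4))) (n<[1+n/4]*4 n))
    where
    eq : ∀ k → k * 4 ≡ 2 * k + 2 * k
    eq = solve-∀

  lower : ∀ {h c} (s : Shape h c) → n < leaves s → suc (n / 4) + b ≤ blacks s
  lower {zero} s n< =
    -- Black height 0 allows only two NILs, while more than `n ≥ 2` are present.
    contradiction (≤-trans n< (height0⇒leaves≤2 s)) (≤⇒≯ 2≤n)
  -- The bound `n/4<` serves twice: for the size of the removed level and for the minimum over the
  -- trimmed shape.
  lower {suc _} s n< rewrite blacks≡trim s = +-mono-≤ n/4< (lowerBound m (trim s) n/4<)
    where
    n/4< : n / 4 < leaves (trim s)
    n/4< = m<n*o⇒m/o<n (<-≤-trans n< (leaves≤trim*4 s))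

existsMinBlack : ∀ n → ∃[ b ] IsMinBlack n b
existsMinBlack = <-rec _ λ
  { 0 _ → 0 , record { shape = nil ; #leaves≡ = refl ; #blacks≡ = refl
                     ; lowerBound = λ _ _ → z≤n }
  -- The root may be red, so a single key needs no black node.
  ; 1 _ → 0 , record { shape = redNode nil nil ; #leaves≡ = refl ; #blacks≡ = refl
                     ; lowerBound = λ _ _ → z≤n }
  ; n@(suc (suc k)) rec →
      let b , m = rec (m/n<m n 4 (s≤s (s≤s z≤n))) in
      suc (n / 4) + b , isMinBlack-step (s≤s (s≤s z≤n)) m
  }

minBlack : ℕ → ℕ
minBlack n = proj₁ (existsMinBlack n)

minBlack-rec : ∀ {n} → 2 ≤ n → minBlack n ≡ suc (n / 4) + minBlack (n / 4)
minBlack-rec {n} 2≤n = isMinBlack-unique (proj₂ (existsMinBlack n))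
                                         (isMinBlack-step 2≤n (proj₂ (existsMinBlack (n / 4))))

-- From shapes to search trees.

-- The keys of label k s are k + 1, …, k + leaves s ∸ 1 in order.
label : ℕ → Shape h c → ColoredTree
label k nil             = leaf tt
label k (redNode l r)   = node (label k l) (red   , k + leaves l) (label (k + leaves l) r)
label k (blackNode l r) = node (label k l) (black , k + leaves l) (label (k + leaves l) r)

label-color : ∀ k (s : Shape h c) → color (label k s) ≡ c
label-color k nil             = refl
label-color k (redNode l r)   = refl
label-color k (blackNode l r) = refl

label-nodes : ∀ k (s : Shape h c) → suc (#nodes (label k s)) ≡ leaves s
label-nodes k nil             = refl
label-nodes k (redNode l r)   = cong₂ _+_ (label-nodes k l) (label-nodes (k + leaves l) r)
label-nodes k (blackNode l r) = cong₂ _+_ (label-nodes k l) (label-nodes (k + leaves l) r)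

label-red : ∀ k (s : Shape h c) → #red (label k s) ≡ reds s
label-red k nil             = refl
label-red k (redNode l r)   =
  cong₂ (λ x y → x + 1 + y) (label-red k l) (label-red (k + leaves l) r)
label-red k (blackNode l r) =
  cong₂ (λ x y → x + 0 + y) (label-red k l) (label-red (k + leaves l) r)

-- The upper bound for a left subtree and the lower bound for a right one are both the key of their
-- parent, which gives the search tree property.
label-keys : ∀ k (s : Shape h c) → AllKeys (λ x → k < x × x < k + leaves s) (label k s)

label-keys-node : ∀ k (l : Shape h c) (r : Shape h d) {col} →
  AllKeys (λ x → k < x × x < k + (leaves l + leaves r))
          (node (label k l) (col , k + leaves l) (label (k + leaves l) r))
label-keys-node k l r = node
  (All.mapₙ (λ (lo , hi) → lo , <-trans hi k+l<) (label-keys k l))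
  (k<k+l , k+l<)
  (All.mapₙ (λ {x} (lo , hi) → <-trans k<k+l lo , subst (proj₂ x <_) (+-assoc k _ _) hi)
            (label-keys (k + leaves l) r))
  where
  k<k+l : k < k + leaves l
  k<k+l = m<m+n k (leaves>0 l)

  k+l< : k + leaves l < k + (leaves l + leaves r)
  k+l< = +-monoʳ-< k (m<m+n (leaves l) (leaves>0 r))

label-keys k nil             = leaf _
label-keys k (redNode l r)   = label-keys-node k l r
label-keys k (blackNode l r) = label-keys-node k l r

label-searchTree : ∀ k (s : Shape h c) → IsSearchTree (label k s)
label-searchTree k (redNode l r) here =
  All.mapₙ proj₂ (label-keys k l) , All.mapₙ proj₁ (label-keys (k + leaves l) r)
label-searchTree k (redNode l r) (left sub)    = label-searchTree k l sub
label-searchTree k (redNode l r) (right sub)   = label-searchTree (k + leaves l) r sub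
label-searchTree k (blackNode l r) here =
  All.mapₙ proj₂ (label-keys k l) , All.mapₙ proj₁ (label-keys (k + leaves l) r)
label-searchTree k (blackNode l r) (left sub)  = label-searchTree k l sub
label-searchTree k (blackNode l r) (right sub) = label-searchTree (k + leaves l) r sub

label-redHasBlackChildren : ∀ k (s : Shape h c) → RedHasBlackChildren (label k s)
label-redHasBlackChildren k (redNode l r) here =
  label-color k l , label-color (k + leaves l) r
label-redHasBlackChildren k (redNode l r) (left sub)    = label-redHasBlackChildren k l sub
label-redHasBlackChildren k (redNode l r) (right sub)   = label-redHasBlackChildren (k + leaves l) r sub
label-redHasBlackChildren k (blackNode l r) (left sub)  = label-redHasBlackChildren k l sub
label-redHasBlackChildren k (blackNode l r) (right sub) = label-redHasBlackChildren (k + leaves l) r sub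

-- The extra one is the final NIL, which `h` omits and `#black` counts.
label-#black : ∀ k (s : Shape h c) (π : Path (label k s)) → #black π ≡ suc h
label-#black k nil stop                  = refl
label-#black k (redNode l r) (left π)    = label-#black k l π
label-#black k (redNode l r) (right π)   = label-#black (k + leaves l) r π
label-#black k (blackNode l r) (left π)  = cong suc (label-#black k l π)
label-#black k (blackNode l r) (right π) = cong suc (label-#black (k + leaves l) r π)

label-blackBalanced : ∀ k (s : Shape h c) → BlackBalanced (label k s)
label-blackBalanced k s@nil here π ρ =
  trans (label-#black k s π) (sym (label-#black k s ρ))
label-blackBalanced k s@(redNode _ _) here π ρ =
  trans (label-#black k s π) (sym (label-#black k s ρ))
label-blackBalanced k s@(blackNode _ _) here π ρ =
  trans (label-#black k s π) (sym (label-#black k s ρ))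
label-blackBalanced k (redNode l r) (left sub)    = label-blackBalanced k l sub
label-blackBalanced k (redNode l r) (right sub)   = label-blackBalanced (k + leaves l) r sub
label-blackBalanced k (blackNode l r) (left sub)  = label-blackBalanced k l sub
label-blackBalanced k (blackNode l r) (right sub) = label-blackBalanced (k + leaves l) r sub

label-isRedBlack : ∀ k (s : Shape h c) → IsRedBlack (label k s)
label-isRedBlack k s = record
  { searchTree          = label-searchTree k s
  ; redHasBlackChildren = label-redHasBlackChildren k s
  ; blackBalanced       = label-blackBalanced k s
  }

-- From trees to shapes.

-- The path serves to compare the black heights of sibling subtrees.
record ShapeOf (t : ColoredTree) : Set where
  constructor shaped
  field
    {height} : ℕ
    {top}    : Color
    top≡     : color t ≡ top
    shape    : Shape height top
    leaves≡  : leaves shape ≡ suc (#nodes t)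
    red≡     : reds shape ≡ #red t
    path     : Path t
    path≡    : #black path ≡ suc height

shapeOf : ∀ t → RedHasBlackChildren t → BlackBalanced t → ShapeOf t
shapeOf (leaf _) _ _ = shaped refl nil refl refl stop refl
shapeOf (node l (c , _) r) rbc bal
  with shaped {hˡ} topˡ sˡ leavesˡ redˡ πˡ hˡ≡ ← shapeOf l (rbc ∘ left) (bal ∘ left)
  with shaped {hʳ} topʳ sʳ leavesʳ redʳ πʳ hʳ≡ ← shapeOf r (rbc ∘ right) (bal ∘ right)
  -- Balance at the root applied to the two stored paths, with the root's own contribution
  -- cancelled, makes the black heights of the siblings equal.
  with refl ← suc-injective (trans (sym hˡ≡)
    (trans (+-cancelˡ-≡ (blackOne c) _ _ (bal here (left πˡ) (right πʳ))) hʳ≡))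
  with c
... | black = shaped refl (blackNode sˡ sʳ) (cong₂ _+_ leavesˡ leavesʳ)
                (cong₂ (λ x y → x + 0 + y) redˡ redʳ) (left πˡ) (cong suc hˡ≡)
... | red
  with refl ← trans (sym topˡ) (proj₁ (rbc here))
  with refl ← trans (sym topʳ) (proj₂ (rbc here))
  = shaped refl (redNode sˡ sʳ) (cong₂ _+_ leavesˡ leavesʳ)
      (cong₂ (λ x y → x + 1 + y) redˡ redʳ) (left πˡ) hˡ≡

-- With the number of keys fixed, red and black counts are complementary.
isMinBlack⇒isMaxRed : ∀ {n b} → IsMinBlack n b → IsMaxRed n (n ∸ b)
isMinBlack⇒isMaxRed {n} {b} m = record
  { attained   = label 0 (shape m)
               , label-isRedBlack 0 (shape m)
               , suc-injective (trans (label-nodes 0 (shape m)) (#leaves≡ m))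
               , trans (label-red 0 (shape m))
                       (trans (reds≡ (shape m) (#leaves≡ m)) (cong (n ∸_) (#blacks≡ m)))
  ; upperBound = upper
  }
  where
  upper : ∀ t → IsRedBlack t → #nodes t ≡ n → #red t ≤ n ∸ b
  upper t rb refl
    with shaped _ s leaves≡ red≡ _ _ ←
           shapeOf t (IsRedBlack.redHasBlackChildren rb) (IsRedBlack.blackBalanced rb)
    rewrite sym red≡ | reds≡ s leaves≡ =
    ∸-monoʳ-≤ (#nodes t) (lowerBound m s (≤-reflexive (sym leaves≡)))

-- The closed forms of `p` and `q`.

2^⌊log2⌋n≤n : ∀ n .{{_ : NonZero n}} (rec : Acc _<_ n) → 2 ^ ⌊log2⌋ n rec ≤ n
2^⌊log2⌋n≤n 1 _ = ≤-refl
2^⌊log2⌋n≤n (suc (suc n)) (acc rs) = begin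
  -- The logarithm recurses on `suc ⌊ n /2⌋`; since the accessibility proof is arbitrary, the
  -- induction hypothesis fits this call.
  2 * 2 ^ ⌊log2⌋ (suc ⌊ n /2⌋) _ ≤⟨ *-monoʳ-≤ 2 (2^⌊log2⌋n≤n (suc ⌊ n /2⌋) _) ⟩
  2 * suc ⌊ n /2⌋                ≡⟨ eq ⌊ n /2⌋ ⟩
  2 + (⌊ n /2⌋ + ⌊ n /2⌋)        ≤⟨ +-monoʳ-≤ 2 (+-monoʳ-≤ ⌊ n /2⌋ (⌊n/2⌋≤⌈n/2⌉ n)) ⟩
  2 + (⌊ n /2⌋ + ⌈ n /2⌉)        ≡⟨ cong (2 +_) (⌊n/2⌋+⌈n/2⌉≡n n) ⟩
  2 + n                          ∎
  where
  open ≤-Reasoning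
  eq : ∀ k → 2 * suc k ≡ 2 + (k + k)
  eq = solve-∀

module _ {n : ℕ} (n≥8 : n ≥ 8) where
  private
    L-2 δ a : ℕ
    L-2 = ⌊log₂ n ⌋ ∸ 2
    δ   = n ∸ 2 ^ ⌊log₂ n ⌋
    a   = 2 ^ L-2

    2+L-2≡L : 2 + L-2 ≡ ⌊log₂ n ⌋
    2+L-2≡L = m+[n∸m]≡n (≤-trans (n≤1+n 2) (⌊log₂⌋-mono-≤ n≥8))

    2^[L∸1]≡2*a : 2 ^ (⌊log₂ n ⌋ ∸ 1) ≡ 2 * a
    2^[L∸1]≡2*a = cong (λ L → 2 ^ (L ∸ 1)) (sym 2+L-2≡L)

    -- The leading power of two is divisible by 4, so division by 4 acts on the remainder `δ` alone.
    a*4+δ≡n : a * 4 + δ ≡ n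
    a*4+δ≡n = begin
      a * 4 + δ           ≡⟨ cong (_+ δ) (eq a) ⟩
      2 ^ (2 + L-2) + δ   ≡⟨ cong (λ L → 2 ^ L + δ) 2+L-2≡L ⟩
      2 ^ ⌊log₂ n ⌋ + δ   ≡⟨ m+[n∸m]≡n (2^⌊log2⌋n≤n n {{>-nonZero (≤-trans (s≤s z≤n) n≥8)}} (<-wellFounded n)) ⟩
      n                   ∎
      where
      open ≡-Reasoning
      eq : ∀ a → a * 4 ≡ 2 * (2 * a)
      eq = solve-∀

    n/4≡a+δ/4 : n / 4 ≡ a + δ / 4
    n/4≡a+δ/4 = begin
      n / 4                 ≡⟨ cong (_/ 4) a*4+δ≡n ⟨
      (a * 4 + δ) / 4       ≡⟨ +-distrib-/-∣ˡ δ (n∣m*n a) ⟩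
      a * 4 / 4 + δ / 4     ≡⟨ cong (_+ δ / 4) (m*n/n≡m a 4) ⟩
      a + δ / 4             ∎
      where open ≡-Reasoning

    -- Rounding up adds 3, which together with the 1 makes a full 4.
    ⌈[δ+1]/4⌉≡1+δ/4 : ⌈ (δ + 1) / 4 ⌉ ≡ suc (δ / 4)
    ⌈[δ+1]/4⌉≡1+δ/4 = begin
      (δ + 1 + 3) / 4       ≡⟨ cong (_/ 4) (eq δ) ⟩
      (1 * 4 + δ) / 4       ≡⟨ +-distrib-/-∣ˡ {4} δ {4} (n∣m*n 1) ⟩
      suc (δ / 4)           ∎
      where
      open ≡-Reasoning
      eq : ∀ δ → δ + 1 + 3 ≡ 1 * 4 + δ
      eq = solve-∀

  p≡n/4 : p n ≡ n / 4
  p≡n/4 = begin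
    a + ⌈ (δ + 1) / 4 ⌉ ∸ 1   ≡⟨ cong (λ x → a + x ∸ 1) ⌈[δ+1]/4⌉≡1+δ/4 ⟩
    a + suc (δ / 4) ∸ 1       ≡⟨ cong (_∸ 1) (+-suc a (δ / 4)) ⟩
    a + δ / 4                 ≡⟨ n/4≡a+δ/4 ⟨
    n / 4                     ∎
    where open ≡-Reasoning

  q≡n∸2*[1+n/4]+1 : q n ≡ n ∸ 2 * suc (n / 4) + 1
  q≡n∸2*[1+n/4]+1 = cong (_+ 1) (begin
    n ∸ 2 ^ (⌊log₂ n ⌋ ∸ 1) ∸ 2 * ⌈ (δ + 1) / 4 ⌉ ≡⟨ cong₂ (λ x y → n ∸ x ∸ 2 * y) 2^[L∸1]≡2*a ⌈[δ+1]/4⌉≡1+δ/4 ⟩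
    n ∸ 2 * a ∸ 2 * suc (δ / 4)                   ≡⟨ ∸-+-assoc n (2 * a) _ ⟩
    n ∸ (2 * a + 2 * suc (δ / 4))                 ≡⟨ cong (n ∸_) (eq a (δ / 4)) ⟩
    n ∸ 2 * suc (a + δ / 4)                       ≡⟨ cong (λ x → n ∸ 2 * suc x) n/4≡a+δ/4 ⟨
    n ∸ 2 * suc (n / 4)                           ∎)
    where
    open ≡-Reasoning
    eq : ∀ a x → 2 * a + 2 * suc x ≡ 2 * suc (a + x)
    eq = solve-∀

-- The recurrence for the number of red nodes.

∸-recombine : ∀ {n k b} → b ≤ k → 2 * suc k ≤ n →
              n ∸ (suc k + b) ≡ (k ∸ b) + (n ∸ 2 * suc k + 1)
∸-recombine {b = b} b≤k 2k≤n
  -- Writing `k` as `b + x` and `n` as `2 * suc k + y` removes every subtraction and leaves a ring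
  -- identity.
  with x , refl ← m≤n⇒∃[o]m+o≡n b≤k
  with y , refl ← m≤n⇒∃[o]m+o≡n 2k≤n
  rewrite m+n∸m≡n b x | m+n∸m≡n (2 * suc (b + x)) y =
  trans (cong (_∸ (suc (b + x) + b)) (eq b x y))
        (m+n∸m≡n (suc (b + x) + b) (x + (y + 1)))
  where
  eq : ∀ b x y → 2 * suc (b + x) + y ≡ (suc (b + x) + b) + (x + (y + 1))
  eq = solve-∀

maxRed : ℕ → ℕ
maxRed n = n ∸ minBlack n

-- Growing from `n / 4` keys adds `n ∸ n / 4` nodes, of which `suc (n / 4)` are black; the last
-- summand counts the new red ones.
maxRed-rec : ∀ {n} → n ≥ 2 → maxRed n ≡ maxRed (n / 4) + (n ∸ 2 * suc (n / 4) + 1)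
maxRed-rec {n} n≥2 = trans (cong (n ∸_) (minBlack-rec n≥2))
  (∸-recombine (isMinBlack-≤ (proj₂ (existsMinBlack (n / 4)))) (2*[1+n/4]≤n n≥2))

maxRed-small : ∀ {n} → n ≥ 1 → n < 8 → maxRed n ≡ n ∸ ⌊log₂ n ⌋
-- For each numeral the well-founded recursion in `existsMinBlack` evaluates.
maxRed-small {1} _ _ = refl
maxRed-small {2} _ _ = refl
maxRed-small {3} _ _ = refl
maxRed-small {4} _ _ = refl
maxRed-small {5} _ _ = refl
maxRed-small {6} _ _ = refl
maxRed-small {7} _ _ = refl
maxRed-small {suc (suc (suc (suc (suc (suc (suc (suc n)))))))} _ n<8 =
  contradiction n<8 (≤⇒≯ (m≤m+n 8 n))

theorem2 : Σ[ r ∈ (ℕ → ℕ) ] ((∀ (n : ℕ) → IsMaxRed n (r n)) ×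
    (∀ (n : ℕ) → n ≥ 1 →
    (n < 8 → r n ≡ n ∸ ⌊log₂ n ⌋) ×
    (n ≥ 8 → r n ≡ r (p n) + q n)))
theorem2 = maxRed , (λ n → isMinBlack⇒isMaxRed (proj₂ (existsMinBlack n))) , λ n n≥1 →
    maxRed-small n≥1
  , λ n≥8 → trans (maxRed-rec (≤-trans (m≤m+n 2 6) n≥8))
                  (cong₂ (λ x y → maxRed x + y) (sym (p≡n/4 n≥8)) (sym (q≡n∸2*[1+n/4]+1 n≥8)))
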